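{- For every integer $n\ge 1$, $|\mathcal{S}_n(32;\,3\to 1)| = C_n$, where $C_n=\frac{1}{n+1}\binom{2n}{n}$ is the $n$-th Catalan number.
   Context: $[n]=\{1,\dots,n\}$, and $\mathcal{S}_n$ is the set of permutations $\pi=\pi_1\pi_2\cdots\pi_n$ of $[n]$ in one-line notation. The permutation $\hat\pi$: for $\pi\in\mathcal{S}_n$, $\hat\pi\in\mathcal{S}_n$ is the permutation whose cycle form is obtained from the word $\pi_1\cdots\pi_n$ by inserting a left parenthesis before each left-to-right maximum (an entry larger than all entries to its left) and a right parenthesis immediately before the next left-to-right maximum, or at the end of the word. A cycle $(c_1,c_2,\dots,c_s)$ means $c_1\mapsto c_2\mapsto\cdots\mapsto c_s\mapsto c_1$. Example: if $\pi=2537164$ then $\hat\pi=(2)(53)(7164)$. Arrow patterns: an arrow pattern of size $k$ is a pair $(\nu;H)$ where $\nu=\nu_1\cdots\nu_m$ is a word of distinct positive integers, $H$ is a collection of arrows $b_i\to c_i$, and the set of all integers appearing in $\nu$ or $H$ is $[k]$. A permutation $\pi\in\mathcal{S}_n$ contains $(\nu;H)$ if there are a set $X=\{x_1<x_2<\cdots<x_k\}\subseteq[n]$ and indices $t_1<\cdots<t_m$ such that $\pi_{t_1}\pi_{t_2}\cdots\pi_{t_m}=x_{\nu_1}x_{\nu_2}\cdots x_{\nu_m}$ and $\hat\pi(x_{b_i})=x_{c_i}$ for every arrow $b_i\to c_i$ in $H$. Otherwise $\pi$ avoids $(\nu;H)$. $\mathcal{S}_n(\nu;H)$ is the set of permutations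 in $\mathcal{S}_n$ avoiding $(\nu;H)$. -}

module Defs where

open import Data.Fin.Base using (Fin; _<_)
open import Data.Fin.Patterns using (0F; 1F; 2F; 3F; 4F; 5F; 6F)
open import Data.Fin.Permutation using (Permutation′; _⟨$⟩ʳ_)
open import Data.Fin.Properties using (_≟_; _<?_)
open import Data.List.Base using (List; []; _∷_; foldr; length; lookup; map; tabulate)
open import Data.List.Membership.Propositional using (_∈_)
open import Data.List.Relation.Unary.All using (All; []; _∷_)
open import Data.List.Relation.Unary.AllPairs using ([]; _∷_)
open import Data.List.Relation.Unary.Any using (Any; here; there)
open import Data.List.Relation.Unary.Unique.Propositional using (Unique)
open import Data.Nat.Base using (ℕ; suc; _*_; _/_)
open import Data.Nat.Combinatorics using (_C_)
open import Data.Product.Base using (Σ; _×_; _,_)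
open import Data.Sum.Base using (_⊎_; inj₁; inj₂)
open import Function.Base using (id; _∘_)
open import Function.Bundles using (Inverse)
open import Level using (0ℓ)
open import Relation.Binary.Bundles using (Setoid)
open import Relation.Binary.Core using (_Preserves_⟶_)
open import Relation.Binary.PropositionalEquality
  using (_≡_; refl; setoid; _→-setoid_)
import Relation.Binary.Construct.On as On
open import Relation.Nullary.Decidable.Core using (yes; no)
open import Relation.Nullary.Negation.Core using (¬_)

-- Conventions: [n] is represented by Fin n, so every label is one less than
-- in the usual notation; 𝒮ₙ is Permutation′ n, with π_i = π ⟨$⟩ʳ i.

oneLine : ∀ {n} → Permutation′ n → List (Fin n)
oneLine π = tabulate (π ⟨$⟩ʳ_)

-- The argument m is the largest entry read so far, so a letter y with m < y
-- is a left-to-right maximum and opens a new cycle.  The result is the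
-- remainder of the current cycle together with the cycles after it.
splitAtMaxima : ∀ {n} → Fin n → List (Fin n) → List (Fin n) × List (List (Fin n))
splitAtMaxima m []      = [] , []
splitAtMaxima m (y ∷ w) with m <? y
... | yes _ = let (c , cs) = splitAtMaxima y w in [] , (y ∷ c) ∷ cs
... | no  _ = let (c , cs) = splitAtMaxima m w in (y ∷ c) , cs

cycleForm : ∀ {n} → List (Fin n) → List (List (Fin n))
cycleForm []      = []
cycleForm (x ∷ w) = let (c , cs) = splitAtMaxima x w in (x ∷ c) ∷ cs

-- 2537164 ↦ (2)(53)(7164)
_ : cycleForm {7} (1F ∷ 4F ∷ 2F ∷ 6F ∷ 0F ∷ 5F ∷ 3F ∷ [])
    ≡ (1F ∷ []) ∷ (4F ∷ 2F ∷ []) ∷ (6F ∷ 0F ∷ 5F ∷ 3F ∷ []) ∷ []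
_ = refl

-- step a c ds x maps c to the head of ds, each letter of ds to the next one, and
-- the last letter to a; all other x are fixed.
step : ∀ {n} → Fin n → Fin n → List (Fin n) → Fin n → Fin n
step a c []       x with x ≟ c
... | yes _ = a
... | no  _ = x
step a c (d ∷ ds) x with x ≟ c
... | yes _ = d
... | no  _ = step a d ds x

cycle : ∀ {n} → List (Fin n) → Fin n → Fin n
cycle []       x = x
cycle (c ∷ cs) x = step c c cs x

-- The cycles of a permutation are disjoint, so the order of
-- composition is immaterial.
fromCycles : ∀ {n} → List (List (Fin n)) → Fin n → Fin n
fromCycles = foldr (λ c f → cycle c ∘ f) id

hat : ∀ {n} → Permutation′ n → Fin n → Fin n
hat π = fromCycles (cycleForm (oneLine π))

_ : map (fromCycles {7} ((1F ∷ []) ∷ (4F ∷ 2F ∷ []) ∷ (6F ∷ 0F ∷ 5F ∷ 3F ∷ []) ∷ []))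
        (0F ∷ 1F ∷ 2F ∷ 3F ∷ 4F ∷ 5F ∷ 6F ∷ [])
    ≡ 5F ∷ 1F ∷ 4F ∷ 6F ∷ 2F ∷ 3F ∷ 0F ∷ []
_ = refl

-- A pair (b , c) in arrows is the arrow b → c.
record ArrowPattern (k : ℕ) : Set where
  field
    word     : List (Fin k)
    arrows   : List (Fin k × Fin k)
    distinct : Unique word
    covers   : ∀ i → i ∈ word ⊎ Any (λ (b , c) → i ≡ b ⊎ i ≡ c) arrows

-- X = {x₁ < ⋯ < x_k} is given by its increasing enumeration x.
Contains : ∀ {n k} → Permutation′ n → ArrowPattern k → Set
Contains {n} {k} π p =
  Σ (Fin k → Fin n) λ x → Σ (Fin (length word) → Fin n) λ t →
    x Preserves _<_ ⟶ _<_
    × t Preserves _<_ ⟶ _<_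
    × (∀ i → π ⟨$⟩ʳ t i ≡ x (lookup word i))
    × All (λ (b , c) → hat π (x b) ≡ x c) arrows
  where open ArrowPattern p

Avoids : ∀ {n k} → Permutation′ n → ArrowPattern k → Set
Avoids π p = ¬ Contains π p

-- 𝒮ₙ(ν;H).  Its elements are compared as maps only: neither the stored inverse
-- nor the proof of avoidance distinguishes two elements.
𝒮 : ∀ {k} → ℕ → ArrowPattern k → Setoid 0ℓ 0ℓ
𝒮 n p = On.setoid {B = Σ (Permutation′ n) (λ π → Avoids π p)}
          (Fin n →-setoid Fin n) (λ (π , _) → π ⟨$⟩ʳ_)

HasCardinality : Setoid 0ℓ 0ℓ → ℕ → Set
HasCardinality S c = Inverse S (setoid (Fin c))

-- The division is exact.
catalan : ℕ → ℕ
catalan n = ((2 * n) C n) / suc n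

-- (32; 3→1)
pattern32-3→1 : ArrowPattern 3
pattern32-3→1 = record
  { word     = 2F ∷ 1F ∷ []
  ; arrows   = (2F , 0F) ∷ []
  ; distinct = ((λ ()) ∷ []) ∷ [] ∷ []
  ; covers   = λ where
      0F → inj₂ (here (inj₂ refl))
      1F → inj₁ (there (here refl))
      2F → inj₁ (here refl)
  }

{-# OPTIONS --safe #-}

-- If π̂ maps a letter c to a smaller letter, then that letter is the successor
-- of c in the word π: the last letter of a cycle is mapped to the maximum of the
-- cycle.  Hence avoiding (32; 3→1) means avoiding the vincular pattern 31-2.
-- A word c₁c₂⋯ avoids 31-2 iff its tail does and c₂ ≥ c₁ − 1 after standardising
-- the tail.  So if A(n , h) counts the avoiders of length n with first letter at
-- least h − 1 (counted from 0), comparing the first letter with h gives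
-- A(n + 1 , h + 1) = A(n + 1 , h + 2) + A(n , h).  This is the recurrence of the
-- ballot numbers, and A(n , 0) is the Catalan number.
module Submission where

open import Data.Fin.Base as Fin using (Fin; zero; suc; toℕ; fromℕ<; punchIn)
open import Data.Fin.Patterns using (0F; 1F; 2F)
open import Data.Fin.Permutation as Permutation
  using (Permutation′; _⟨$⟩ʳ_; _⟨$⟩ˡ_; _≈_; inverseʳ; inverseˡ; remove; insert;
         punchIn-permute; insert-punchIn; insert-remove)
open import Data.Fin.Properties
  using (_≟_; _<?_; suc-injective; toℕ-injective; toℕ<n; toℕ-fromℕ<;
         punchIn-mono-≤; punchIn-cancel-≤; punchIn-injective; +↔⊎)
open import Data.List.Base using (List; []; _∷_; _++_; concat; lookup; tabulate)
open import Data.List.Membership.Propositional using (_∈_; _∉_)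
open import Data.List.Membership.Propositional.Properties using (∈-++⁺ˡ; ∈-++⁺ʳ; ∈-tabulate⁻)
open import Data.List.Relation.Unary.All using ([]; _∷_)
open import Data.List.Relation.Unary.Any using (here; there)
open import Data.Nat.Base as ℕ
  using (ℕ; zero; suc; _+_; _*_; _/_; _≤_; _<_; z≤n; s≤s; z<s; s<s; NonZero)
open import Data.Nat.Combinatorics using (_C_; nCk≡nC[n∸k]; nCn≡1; nCk+nC[k+1]≡[n+1]C[k+1])
open import Data.Nat.DivMod using (m*n/n≡m)
import Data.Nat.Properties as ℕ
open import Data.Nat.Tactic.RingSolver using (solve-∀)
open import Data.Product.Base using (Σ; ∃; _×_; _,_; proj₁; proj₂)
open import Data.Sum.Base as Sum using (_⊎_; inj₁; inj₂)
open import Data.Sum.Function.Setoid using (_⊎-inverse_)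
open import Data.Sum.Relation.Binary.Pointwise using (_⊎ₛ_; inj₁; inj₂; Pointwise-≡↔≡)
open import Function.Base using (_∘_)
open import Function.Bundles using (Inverse)
import Function.Construct.Composition as Composition
import Function.Construct.Symmetry as Symmetry
open import Function.Definitions using (Injective)
open import Function.Properties.Bijection using (Bijection⇒Inverse)
open import Level using (0ℓ)
open import Relation.Binary.Bundles using (Setoid)
import Relation.Binary.Construct.On as On
open import Relation.Binary.Core using (_Preserves_⟶_)
open import Relation.Binary.PropositionalEquality
open import Relation.Nullary using (yes; no; contradiction; ¬_)

open import Defs

private variable
  n l h : ℕ

-- Ballot numbers

C-zero : ∀ n → n C 0 ≡ 1
C-zero n = trans (nCk≡nC[n∸k] {0} {n} z≤n) (nCn≡1 n)

C-symmetric : ∀ j k → (j + k) C j ≡ (j + k) C k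
C-symmetric j k = trans (nCk≡nC[n∸k] (ℕ.m≤m+n j k)) (cong ((j + k) C_) (ℕ.m+n∸m≡n j k))

C-absorption : ∀ n k → suc k * (suc n C suc k) ≡ suc n * (n C k)
C-absorption zero zero = refl
C-absorption zero (suc k) = ℕ.*-zeroʳ (suc (suc k))
C-absorption n@(suc n′) zero = begin
  1 * (suc n C 1)      ≡⟨ cong (1 *_) (nCk+nC[k+1]≡[n+1]C[k+1] n 0) ⟨
  1 * (n C 0 + n C 1)  ≡⟨ lemma (n C 0) (n C 1) ⟩
  n C 0 + 1 * (n C 1)  ≡⟨ cong (n C 0 +_) (C-absorption n′ 0) ⟩
  n C 0 + n * (n′ C 0) ≡⟨ cong (λ c → n C 0 + n * c) (trans (C-zero n′) (sym (C-zero n))) ⟩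
  suc n * (n C 0)      ∎
  where
  open ≡-Reasoning
  lemma : ∀ x y → 1 * (x + y) ≡ x + 1 * y
  lemma = solve-∀
C-absorption n@(suc n′) k@(suc k′) = begin
  suc k * (suc n C suc k)
    ≡⟨ cong (suc k *_) (nCk+nC[k+1]≡[n+1]C[k+1] n k) ⟨
  suc k * (n C k + n C suc k)
    ≡⟨ lemma k (n C k) (n C suc k) ⟩
  n C k + (k * (n C k) + suc k * (n C suc k))
    ≡⟨ cong (n C k +_) (cong₂ _+_ (C-absorption n′ k′) (C-absorption n′ k)) ⟩
  n C k + (n * (n′ C k′) + n * (n′ C k))
    ≡⟨ cong (n C k +_) (ℕ.*-distribˡ-+ n (n′ C k′) (n′ C k)) ⟨
  n C k + n * (n′ C k′ + n′ C k)
    ≡⟨ cong (λ c → n C k + n * c) (nCk+nC[k+1]≡[n+1]C[k+1] n′ k′) ⟩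
  suc n * (n C k) ∎
  where
  open ≡-Reasoning
  lemma : ∀ k x y → suc k * (x + y) ≡ x + (k * x + suc k * y)
  lemma = solve-∀

-- Counts the lattice paths from height `h` down to 0 with `r` up steps and `h + r` down steps that
-- never go below 0.
ballot : ℕ → ℕ → ℕ
ballot zero    h       = 1
ballot (suc r) zero    = ballot r 1
ballot (suc r) (suc h) = ballot r (2 + h) + ballot (suc r) h

-- n C (k − 1); the value 0 at k = 0 makes Pascal's rule hold for every k.
_C-pred_ : ℕ → ℕ → ℕ
n C-pred zero  = 0
n C-pred suc k = n C k

C-pascal : ∀ n k → n C-pred k + n C k ≡ suc n C k
C-pascal n zero    = trans (C-zero n) (sym (C-zero (suc n)))
C-pascal n (suc k) = nCk+nC[k+1]≡[n+1]C[k+1] n k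

-- The reflection principle: `n C r` counts all paths with `r` up steps among `n`, and `n C-pred r`
-- those that go below 0. The induction removes the first step on the left and applies Pascal's rule
-- to both binomials.
ballot-reflection : ∀ r h {n} → n ≡ h + (r + r) → ballot r h + n C-pred r ≡ n C r
ballot-reflection zero h {n} eq = sym (C-zero n)
ballot-reflection (suc r) zero {zero} ()
ballot-reflection (suc r) zero {suc n} eq = begin
  ballot r 1 + suc n C r              ≡⟨ cong (ballot r 1 +_) (C-pascal n r) ⟨
  ballot r 1 + (n C-pred r + n C r)   ≡⟨ ℕ.+-assoc (ballot r 1) _ _ ⟨
  (ballot r 1 + n C-pred r) + n C r   ≡⟨ cong₂ _+_ (ballot-reflection r 1 (trans n≡ (ℕ.+-suc r r))) middle ⟩
  n C r + n C suc r                   ≡⟨ C-pascal n (suc r) ⟩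
  suc n C suc r                       ∎
  where
  open ≡-Reasoning
  n≡ : n ≡ r + suc r
  n≡ = ℕ.suc-injective eq
  -- At height 0 there is no down step to count. Row `n` is odd, and the equality of its two middle
  -- entries replaces the missing induction hypothesis.
  middle : n C r ≡ n C suc r
  middle = subst (λ m → m C r ≡ m C suc r) (sym n≡) (C-symmetric r (suc r))
ballot-reflection (suc r) (suc h) {zero} ()
ballot-reflection (suc r) (suc h) {suc n} eq = begin
  (b₁ + b₂) + suc n C r              ≡⟨ cong (b₁ + b₂ +_) (C-pascal n r) ⟨
  (b₁ + b₂) + (n C-pred r + n C r)   ≡⟨ interchange b₁ b₂ (n C-pred r) (n C r) ⟩
  (b₁ + n C-pred r) + (b₂ + n C r)   ≡⟨ cong₂ _+_ (ballot-reflection r (2 + h) (trans n≡ (shift h r)))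
                                                  (ballot-reflection (suc r) h n≡) ⟩
  n C r + n C suc r                  ≡⟨ C-pascal n (suc r) ⟩
  suc n C suc r                      ∎
  where
  open ≡-Reasoning
  b₁ = ballot r (2 + h)
  b₂ = ballot (suc r) h
  n≡ : n ≡ h + (suc r + suc r)
  n≡ = ℕ.suc-injective eq
  interchange : ∀ a b c d → (a + b) + (c + d) ≡ (a + c) + (b + d)
  interchange = solve-∀
  shift : ∀ h r → h + (suc r + suc r) ≡ 2 + h + (r + r)
  shift = solve-∀

-- By symmetry `k = n − 1` may be replaced by `n + 1`; absorption then turns both sides into `2n`
-- times the middle entry of row `2n − 1`. This converts the difference given by reflection into a
-- quotient by `n + 1`.
central-C-pred : ∀ n → suc n * ((n + n) C-pred n) ≡ n * ((n + n) C n)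
central-C-pred zero = refl
central-C-pred n@(suc k) = begin
  suc n * ((n + n) C k)         ≡⟨ cong (λ m → suc n * (m C k)) n+n≡k+sn ⟩
  suc n * ((k + suc n) C k)     ≡⟨ cong (suc n *_) (C-symmetric k (suc n)) ⟩
  suc n * ((k + suc n) C suc n) ≡⟨ cong (λ m → suc n * (m C suc n)) n+n≡k+sn ⟨
  suc n * ((n + n) C suc n)     ≡⟨ C-absorption (k + n) n ⟩
  (n + n) * ((k + n) C n)       ≡⟨ cong ((n + n) *_) (C-symmetric k n) ⟨
  (n + n) * ((k + n) C k)       ≡⟨ C-absorption (k + n) k ⟨
  n * ((n + n) C n)             ∎
  where
  open ≡-Reasoning
  n+n≡k+sn : n + n ≡ k + suc n
  n+n≡k+sn = sym (ℕ.+-suc k n)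

ballot-catalan : ∀ n → ballot n 0 ≡ catalan n
ballot-catalan n = begin
  ballot n 0                   ≡⟨ m*n/n≡m (ballot n 0) (suc n) ⟨
  ballot n 0 * suc n / suc n   ≡⟨ cong (_/ suc n) product ⟩
  ((n + n) C n) / suc n        ≡⟨ cong (λ m → ((n + m) C n) / suc n) (ℕ.+-identityʳ n) ⟨
  catalan n                    ∎
  where
  open ≡-Reasoning
  product : ballot n 0 * suc n ≡ (n + n) C n
  -- The added term equals `suc n * ((n + n) C-pred n)`, so reflection applies without subtraction.
  product = ℕ.+-cancelʳ-≡ (n * ((n + n) C n)) _ _ (begin
    ballot n 0 * suc n + n * ((n + n) C n)
      ≡⟨ cong₂ _+_ (ℕ.*-comm (ballot n 0) (suc n)) (sym (central-C-pred n)) ⟩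
    suc n * ballot n 0 + suc n * ((n + n) C-pred n)
      ≡⟨ ℕ.*-distribˡ-+ (suc n) (ballot n 0) _ ⟨
    suc n * (ballot n 0 + (n + n) C-pred n)
      ≡⟨ cong (suc n *_) (ballot-reflection n 0 refl) ⟩
    (n + n) C n + n * ((n + n) C n) ∎)

-- The map π̂

step-∈ : ∀ (a c : Fin n) ds x → step a c ds x ≡ x ⊎ step a c ds x ∈ a ∷ ds
step-∈ a c [] x with x ≟ c
... | yes _ = inj₂ (here refl)
... | no _  = inj₁ refl
step-∈ a c (d ∷ ds) x with x ≟ c
... | yes _ = inj₂ (there (here refl))
... | no _  = Sum.map₂ weaken (step-∈ a d ds x)
  where
  weaken : ∀ {y} → y ∈ a ∷ ds → y ∈ a ∷ d ∷ ds
  weaken (here eq) = here eq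
  weaken (there p) = there (there p)

step-fixed : ∀ (a c : Fin n) ds {x} → x ∉ c ∷ ds → step a c ds x ≡ x
step-fixed a c [] {x} x∉ with x ≟ c
... | yes eq = contradiction (here eq) x∉
... | no _   = refl
step-fixed a c (d ∷ ds) {x} x∉ with x ≟ c
... | yes eq = contradiction (here eq) x∉
... | no _   = step-fixed a d ds (x∉ ∘ there)

fromCycles-∈ : ∀ (cs : List (List (Fin n))) x → fromCycles cs x ≡ x ⊎ fromCycles cs x ∈ concat cs
fromCycles-∈ [] x = inj₁ refl
fromCycles-∈ ([] ∷ cs) x = fromCycles-∈ cs x
fromCycles-∈ ((c ∷ ds) ∷ cs) x with step-∈ c c ds (fromCycles cs x) | fromCycles-∈ cs x
... | inj₂ p  | _       = inj₂ (∈-++⁺ˡ p)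
... | inj₁ eq | inj₁ e  = inj₁ (trans eq e)
... | inj₁ eq | inj₂ p  = inj₂ (subst (_∈ concat ((c ∷ ds) ∷ cs)) (sym eq) (∈-++⁺ʳ (c ∷ ds) p))

fromCycles-fixed : ∀ (cs : List (List (Fin n))) {x} → x ∉ concat cs → fromCycles cs x ≡ x
fromCycles-fixed [] x∉ = refl
fromCycles-fixed ([] ∷ cs) x∉ = fromCycles-fixed cs x∉
fromCycles-fixed ((c ∷ ds) ∷ cs) {x} x∉
  rewrite fromCycles-fixed cs (x∉ ∘ ∈-++⁺ʳ (c ∷ ds)) = step-fixed c c ds (x∉ ∘ ∈-++⁺ˡ)

splitAtMaxima-concat : ∀ (m : Fin n) w → let (c , cs) = splitAtMaxima m w in c ++ concat cs ≡ w
splitAtMaxima-concat m [] = refl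
splitAtMaxima-concat m (y ∷ w) with m <? y
... | yes _ = cong (y ∷_) (splitAtMaxima-concat y w)
... | no _  = cong (y ∷_) (splitAtMaxima-concat m w)

-- The part of hat contributed by the suffix c ∷ w of a word, when m is the
-- largest letter so far, hence the first letter of the cycle containing c.
hatFrom : Fin n → Fin n → List (Fin n) → Fin n → Fin n
hatFrom m c w x = let (ds , cs) = splitAtMaxima m w in step m c ds (fromCycles cs x)

later-cycles-⊆ : ∀ (m : Fin n) w {x} → x ∈ concat (proj₂ (splitAtMaxima m w)) → x ∈ w
later-cycles-⊆ m w x∈ = subst (_ ∈_) (splitAtMaxima-concat m w) (∈-++⁺ʳ (proj₁ (splitAtMaxima m w)) x∈)

-- `fromCycles` applies the later cycles first, so `step` compares `c` with their value instead of
-- with `x` itself. This keeps that comparison negative.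
later-cycles-≢ : ∀ (m : Fin n) w {c x} → c ∉ w → x ≢ c → fromCycles (proj₂ (splitAtMaxima m w)) x ≢ c
later-cycles-≢ m w {c} {x} c∉ x≢c eq with fromCycles-∈ (proj₂ (splitAtMaxima m w)) x
... | inj₁ e = x≢c (trans (sym e) eq)
... | inj₂ p = c∉ (later-cycles-⊆ m w (subst (_∈ _) eq p))

later-cycles-fixed : ∀ (m : Fin n) w {c} → c ∉ w → fromCycles (proj₂ (splitAtMaxima m w)) c ≡ c
later-cycles-fixed m w c∉ = fromCycles-fixed (proj₂ (splitAtMaxima m w)) (c∉ ∘ later-cycles-⊆ m w)

step-head-[] : ∀ (a c : Fin n) → step a c [] c ≡ a
step-head-[] a c with c ≟ c
... | yes _ = refl
... | no c≢c = contradiction refl c≢c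

step-head-∷ : ∀ (a c d : Fin n) ds → step a c (d ∷ ds) c ≡ d
step-head-∷ a c d ds with c ≟ c
... | yes _ = refl
... | no c≢c = contradiction refl c≢c

step-tail-[] : ∀ (a c : Fin n) {x} → x ≢ c → step a c [] x ≡ x
step-tail-[] a c {x} x≢c with x ≟ c
... | yes eq = contradiction eq x≢c
... | no _ = refl

step-tail-∷ : ∀ (a c d : Fin n) ds {x} → x ≢ c → step a c (d ∷ ds) x ≡ step a d ds x
step-tail-∷ a c d ds {x} x≢c with x ≟ c
... | yes eq = contradiction eq x≢c
... | no _ = refl

hatFrom-last : ∀ (m c : Fin n) → hatFrom m c [] c ≡ m
hatFrom-last = step-head-[]

hatFrom-maximum : ∀ {m c y : Fin n} w → c ∉ y ∷ w → m Fin.< y → hatFrom m c (y ∷ w) c ≡ m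
hatFrom-maximum {m = m} {c} {y} w c∉ m<y with m <? y | later-cycles-fixed m (y ∷ w) c∉
... | no m≮y | _ = contradiction m<y m≮y
... | yes _  | fixed = trans (cong (step m c []) fixed) (step-head-[] m c)

hatFrom-next : ∀ {m c y : Fin n} w → c ∉ y ∷ w → y Fin.≤ m → hatFrom m c (y ∷ w) c ≡ y
hatFrom-next {m = m} {c} {y} w c∉ y≤m with m <? y
... | yes m<y = contradiction y≤m (ℕ.<⇒≱ m<y)
... | no _ = trans (cong (step m c (y ∷ proj₁ (splitAtMaxima m w))) (later-cycles-fixed m w (c∉ ∘ there)))
                   (step-head-∷ m c y _)

-- A letter `y` that opens a cycle is both the running maximum and the current letter, and
-- `cycle (y ∷ ds)` unfolds to `step y y ds`.
hatFrom-skip-maximum : ∀ {m c y : Fin n} w {x} → c ∉ y ∷ w → x ≢ c → m Fin.< y →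
                       hatFrom m c (y ∷ w) x ≡ hatFrom y y w x
hatFrom-skip-maximum {m = m} {c} {y} w {x} c∉ x≢c m<y with m <? y | later-cycles-≢ m (y ∷ w) c∉ x≢c
... | no m≮y | _ = contradiction m<y m≮y
... | yes _  | ≢c = step-tail-[] m c ≢c

hatFrom-skip : ∀ {m c y : Fin n} w {x} → c ∉ y ∷ w → x ≢ c → y Fin.≤ m →
               hatFrom m c (y ∷ w) x ≡ hatFrom m y w x
hatFrom-skip {m = m} {c} {y} w {x} c∉ x≢c y≤m with m <? y
... | yes m<y = contradiction y≤m (ℕ.<⇒≱ m<y)
... | no _    = step-tail-∷ m c y _ (later-cycles-≢ m w (c∉ ∘ there) x≢c)

module _ {f : Fin (suc l) → Fin n} (f-injective : Injective _≡_ _≡_ f) where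

  head∉tail : f zero ∉ tabulate (f ∘ suc)
  head∉tail p with ∈-tabulate⁻ p
  ... | _ , eq with f-injective eq
  ... | ()

  later≢head : ∀ i → f (suc i) ≢ f zero
  later≢head i eq with f-injective eq
  ... | ()

-- The lower letter of a descent lies below the running maximum, so it cannot open a cycle and
-- continues the current one. The bound `f zero ≤ m` is the invariant that carries this along the
-- word.
hatFrom-descent : ∀ (f : Fin (suc l) → Fin n) → Injective _≡_ _≡_ f → ∀ {m} → f zero Fin.≤ m →
                  ∀ i j → toℕ j ≡ suc (toℕ i) → f j Fin.< f i →
                  hatFrom m (f zero) (tabulate (f ∘ suc)) (f i) ≡ f j
hatFrom-descent f inj f0≤m zero (suc zero) eq fj<fi =
  hatFrom-next _ (head∉tail inj) (ℕ.<⇒≤ (ℕ.<-≤-trans fj<fi f0≤m))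
hatFrom-descent {suc l} f inj {m} f0≤m (suc i) (suc j) eq fj<fi with ℕ.<-≤-connex (toℕ m) (toℕ (f (suc zero)))
... | inj₁ m<f1 = trans (hatFrom-skip-maximum _ (head∉tail inj) (later≢head inj i) m<f1)
                   (hatFrom-descent (f ∘ suc) (suc-injective ∘ inj) ℕ.≤-refl i j (ℕ.suc-injective eq) fj<fi)
... | inj₂ f1≤m = trans (hatFrom-skip _ (head∉tail inj) (later≢head inj i) f1≤m)
                   (hatFrom-descent (f ∘ suc) (suc-injective ∘ inj) f1≤m i j (ℕ.suc-injective eq) fj<fi)

-- The current letter is last in its cycle when the word ends or the next letter exceeds `m`; its
-- image is then `m`, which is not below it. In the remaining case the image is the next letter.
hatFrom-below : ∀ (f : Fin (suc l) → Fin n) → Injective _≡_ _≡_ f → ∀ {m} → f zero Fin.≤ m →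
                ∀ i → let y = hatFrom m (f zero) (tabulate (f ∘ suc)) (f i) in
                y Fin.< f i → ∃ λ j → toℕ j ≡ suc (toℕ i) × f j ≡ y
hatFrom-below {zero} f inj {m} f0≤m zero y<fi =
  contradiction (subst (Fin._< f zero) (hatFrom-last m (f zero)) y<fi) (ℕ.≤⇒≯ f0≤m)
hatFrom-below {suc l} f inj {m} f0≤m i y<fi with ℕ.<-≤-connex (toℕ m) (toℕ (f (suc zero)))
hatFrom-below {suc l} f inj {m} f0≤m zero y<fi | inj₁ m<f1 =
  contradiction (subst (Fin._< f zero) (hatFrom-maximum _ (head∉tail inj) m<f1) y<fi) (ℕ.≤⇒≯ f0≤m)
hatFrom-below {suc l} f inj {m} f0≤m zero y<fi | inj₂ f1≤m =
  suc zero , refl , sym (hatFrom-next _ (head∉tail inj) f1≤m)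
hatFrom-below {suc l} f inj {m} f0≤m (suc i) y<fi | inj₁ m<f1 =
  let eq = hatFrom-skip-maximum _ (head∉tail inj) (later≢head inj i) m<f1
      (j , j≡ , fj≡) = hatFrom-below (f ∘ suc) (suc-injective ∘ inj) ℕ.≤-refl i (subst (Fin._< f (suc i)) eq y<fi)
  in suc j , cong suc j≡ , trans fj≡ (sym eq)
hatFrom-below {suc l} f inj {m} f0≤m (suc i) y<fi | inj₂ f1≤m =
  let eq = hatFrom-skip _ (head∉tail inj) (later≢head inj i) f1≤m
      (j , j≡ , fj≡) = hatFrom-below (f ∘ suc) (suc-injective ∘ inj) f1≤m i (subst (Fin._< f (suc i)) eq y<fi)
  in suc j , cong suc j≡ , trans fj≡ (sym eq)

-- The vincular pattern 31-2

⟨$⟩ʳ-injective : (π : Permutation′ n) → Injective _≡_ _≡_ (π ⟨$⟩ʳ_)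
⟨$⟩ʳ-injective π {x} {y} eq = trans (sym (inverseˡ π)) (trans (cong (π ⟨$⟩ˡ_) eq) (inverseˡ π))

-- The dash separates letters that need not be adjacent: only 3 and 1 must be.
Contains31-2 : Permutation′ n → Set
Contains31-2 {n} π = Σ (Fin n) λ i → Σ (Fin n) λ j → Σ (Fin n) λ k →
  toℕ j ≡ suc (toℕ i) × j Fin.< k × π ⟨$⟩ʳ j Fin.< π ⟨$⟩ʳ k × π ⟨$⟩ʳ k Fin.< π ⟨$⟩ʳ i

Avoids31-2 : Permutation′ n → Set
Avoids31-2 π = ¬ Contains31-2 π

hat-descent : (π : Permutation′ n) → ∀ i j → toℕ j ≡ suc (toℕ i) → π ⟨$⟩ʳ j Fin.< π ⟨$⟩ʳ i →
              hat π (π ⟨$⟩ʳ i) ≡ π ⟨$⟩ʳ j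
-- `hat` unfolds to `hatFrom` with the first letter of the word as both maximum and current letter.
hat-descent {suc n} π = hatFrom-descent (π ⟨$⟩ʳ_) (⟨$⟩ʳ-injective π) ℕ.≤-refl

hat-below : (π : Permutation′ n) → ∀ i → hat π (π ⟨$⟩ʳ i) Fin.< π ⟨$⟩ʳ i →
            ∃ λ j → toℕ j ≡ suc (toℕ i) × π ⟨$⟩ʳ j ≡ hat π (π ⟨$⟩ʳ i)
hat-below {suc n} π = hatFrom-below (π ⟨$⟩ʳ_) (⟨$⟩ʳ-injective π) ℕ.≤-refl

-- The adjacent letters 3 and 1 form a descent, which gives the arrow; the word 32 is read at
-- positions `i` and `k`.
31-2⇒arrow : (π : Permutation′ n) → Contains31-2 π → Contains π pattern32-3→1
31-2⇒arrow {n} π (i , j , k , j≡ , j<k , j<πk , k<πi) =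
  x , t , x-mono , t-mono , letters , hat-descent π i j j≡ (ℕ.<-trans j<πk k<πi) ∷ []
  where
  x : Fin 3 → Fin n
  x 0F = π ⟨$⟩ʳ j
  x 1F = π ⟨$⟩ʳ k
  x 2F = π ⟨$⟩ʳ i
  t : Fin 2 → Fin n
  t 0F = i
  t 1F = k
  x-mono : x Preserves Fin._<_ ⟶ Fin._<_
  x-mono {0F} {1F} _ = j<πk
  x-mono {0F} {2F} _ = ℕ.<-trans j<πk k<πi
  x-mono {1F} {1F} (s<s ())
  x-mono {1F} {2F} _ = k<πi
  x-mono {2F} {1F} (s<s ())
  x-mono {2F} {2F} (s<s (s<s ()))
  t-mono : t Preserves Fin._<_ ⟶ Fin._<_
  t-mono {0F} {1F} _ = ℕ.<-trans (subst (toℕ i <_) (sym j≡) (ℕ.n<1+n _)) j<k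
  t-mono {1F} {1F} (s<s ())
  letters : ∀ a → π ⟨$⟩ʳ t a ≡ x (lookup (2F ∷ 1F ∷ []) a)
  letters 0F = refl
  letters 1F = refl

arrow⇒31-2 : (π : Permutation′ n) → Contains π pattern32-3→1 → Contains31-2 π
arrow⇒31-2 {n} π (x , t , x-mono , t-mono , letters , hat≡ ∷ []) =
  i , j , k , j≡ , ℕ.≤∧≢⇒< j≤k (j≢k ∘ toℕ-injective) ,
  subst₂ Fin._<_ (sym πj≡x₀) (sym (letters 1F)) (x-mono z<s) ,
  subst₂ Fin._<_ (sym (letters 1F)) (sym (letters 0F)) (x-mono (s<s z<s))
  where
  i k : Fin n
  i = t 0F
  k = t 1F
  hat≡x₀ : hat π (π ⟨$⟩ʳ i) ≡ x 0F
  hat≡x₀ = trans (cong (hat π) (letters 0F)) hat≡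
  next = hat-below π i (subst₂ Fin._<_ (sym hat≡x₀) (sym (letters 0F)) (x-mono z<s))
  j = proj₁ next
  j≡ = proj₁ (proj₂ next)
  πj≡x₀ : π ⟨$⟩ʳ j ≡ x 0F
  πj≡x₀ = trans (proj₂ (proj₂ next)) hat≡x₀
  j≤k : j Fin.≤ k
  j≤k = subst (_≤ toℕ k) (sym j≡) (t-mono z<s)
  j≢k : j ≢ k
  -- Positions `j` and `k` carry the distinct letters `x 0F` and `x 1F`.
  j≢k j≡k = ℕ.<-irrefl (cong toℕ (trans (sym πj≡x₀) (trans (cong (π ⟨$⟩ʳ_) j≡k) (letters 1F)))) (x-mono (z<s {0}))

-- Deleting the first letter and standardising the tail

punchIn-mono-< : ∀ i {j k : Fin n} → j Fin.< k → punchIn i j Fin.< punchIn i k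
punchIn-mono-< i j<k = ℕ.≰⇒> (ℕ.<⇒≱ j<k ∘ punchIn-cancel-≤ i _ _)

punchIn-cancel-< : ∀ i {j k : Fin n} → punchIn i j Fin.< punchIn i k → j Fin.< k
punchIn-cancel-< i j<k = ℕ.≰⇒> (ℕ.<⇒≱ j<k ∘ punchIn-mono-≤ i _ _)

≤-punchIn : ∀ i (j : Fin n) → toℕ j ≤ toℕ (punchIn i j)
≤-punchIn zero j = ℕ.n≤1+n _
≤-punchIn (suc i) zero = z≤n
≤-punchIn (suc i) (suc j) = s≤s (≤-punchIn i j)

punchIn-below : ∀ (i : Fin (suc n)) (j : Fin n) → toℕ j < toℕ i → toℕ (punchIn i j) ≡ toℕ j
punchIn-below (suc i) zero j<i = refl
punchIn-below (suc i) (suc j) (s<s j<i) = cong suc (punchIn-below i j j<i)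

-- For the empty permutation only the bound 0 holds, which makes the recursion
-- on the first letter uniform.
FirstBound : ℕ → Permutation′ n → Set
FirstBound {zero}  h π = h ≡ 0
FirstBound {suc n} h π = h ≤ suc (toℕ (π ⟨$⟩ʳ 0F))

bound≤n : (π : Permutation′ n) → FirstBound h π → h ≤ n
bound≤n {zero}  π refl = z≤n
bound≤n {suc n} π h≤   = ℕ.≤-trans h≤ (toℕ<n (π ⟨$⟩ʳ 0F))

-- The letters of π after the first one form a word order-isomorphic to ρ.
Tail : Permutation′ (suc n) → Permutation′ n → Set
Tail π ρ = ∀ i → π ⟨$⟩ʳ suc i ≡ punchIn (π ⟨$⟩ʳ 0F) (ρ ⟨$⟩ʳ i)

module _ (π : Permutation′ (suc n)) (ρ : Permutation′ n) (tail : Tail π ρ) where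

  tail-mono : ∀ {i j} → ρ ⟨$⟩ʳ i Fin.< ρ ⟨$⟩ʳ j → π ⟨$⟩ʳ suc i Fin.< π ⟨$⟩ʳ suc j
  tail-mono {i} {j} = subst₂ Fin._<_ (sym (tail i)) (sym (tail j)) ∘ punchIn-mono-< (π ⟨$⟩ʳ 0F)

  tail-cancel : ∀ {i j} → π ⟨$⟩ʳ suc i Fin.< π ⟨$⟩ʳ suc j → ρ ⟨$⟩ʳ i Fin.< ρ ⟨$⟩ʳ j
  tail-cancel {i} {j} = punchIn-cancel-< (π ⟨$⟩ʳ 0F) ∘ subst₂ Fin._<_ (tail i) (tail j)

avoids-tail : (π : Permutation′ (suc n)) (ρ : Permutation′ n) → Tail π ρ → Avoids31-2 π → Avoids31-2 ρ
avoids-tail π ρ tail avoids (i , j , k , j≡ , j<k , πj<πk , πk<πi) =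
  avoids (suc i , suc j , suc k , cong suc j≡ , s<s j<k , tail-mono π ρ tail πj<πk , tail-mono π ρ tail πk<πi)

-- If the second letter were below c − 1, where c is the first one, then c − 1
-- would occur after it and complete a 31-2.
avoids⇒bound : (π : Permutation′ (suc n)) (ρ : Permutation′ n) → Tail π ρ → Avoids31-2 π →
               FirstBound (toℕ (π ⟨$⟩ʳ 0F)) ρ
avoids⇒bound {zero} π ρ tail avoids with π ⟨$⟩ʳ 0F
... | 0F = refl
avoids⇒bound {suc n} π ρ tail avoids = ℕ.≮⇒≥ λ below → avoids (occurrence below)
  where
  c = π ⟨$⟩ʳ 0F
  occurrence : suc (toℕ (ρ ⟨$⟩ʳ 0F)) < toℕ c → Contains31-2 π
  occurrence below = 0F , 1F , k , refl , 1<k k refl , subst (π ⟨$⟩ʳ 1F Fin.<_) (sym πk≡b) π1<b ,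
                     subst (Fin._< c) (sym πk≡b) b<c
    where
    instance
      c≢0 : NonZero (toℕ c)
      c≢0 = ℕ.>-nonZero (ℕ.≤-<-trans z≤n below)
    pred<n : ℕ.pred (toℕ c) < suc (suc n)
    pred<n = ℕ.≤-<-trans ℕ.pred[n]≤n (toℕ<n c)
    b : Fin (suc (suc n))
    b = fromℕ< pred<n
    c≡1+b : toℕ c ≡ suc (toℕ b)
    c≡1+b = sym (trans (cong suc (toℕ-fromℕ< pred<n)) (ℕ.suc-pred (toℕ c)))
    b<c : b Fin.< c
    b<c = ℕ.≤-reflexive (sym c≡1+b)
    -- Standardisation does not change letters below `c`.
    π1≡ρ0 : toℕ (π ⟨$⟩ʳ 1F) ≡ toℕ (ρ ⟨$⟩ʳ 0F)
    π1≡ρ0 = trans (cong toℕ (tail 0F)) (punchIn-below c _ (ℕ.<-trans (ℕ.n<1+n _) below))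
    π1<b : π ⟨$⟩ʳ 1F Fin.< b
    π1<b = subst (_< toℕ b) (sym π1≡ρ0) (ℕ.s<s⁻¹ (subst (suc (toℕ (ρ ⟨$⟩ʳ 0F)) <_) c≡1+b below))
    k : Fin (suc (suc n))
    k = π ⟨$⟩ˡ b
    πk≡b : π ⟨$⟩ʳ k ≡ b
    πk≡b = inverseʳ π
    -- Position 0 carries `c`, which is above `b`, and position 1 a letter below `b`; hence `b`
    -- stands further right.
    1<k : ∀ l → k ≡ l → 1 < toℕ l
    1<k zero k≡0 = contradiction b<c (ℕ.<-irrefl (cong toℕ (trans (sym πk≡b) (cong (π ⟨$⟩ʳ_) k≡0))))
    1<k (suc zero) k≡1 = contradiction π1<b (ℕ.<-irrefl (cong toℕ (trans (cong (π ⟨$⟩ʳ_) (sym k≡1)) πk≡b)))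
    1<k (suc (suc _)) _ = s<s z<s

-- An occurrence within the tail passes to `ρ`. One that starts at the first letter uses the second
-- letter as its 1; since `punchIn` never lowers a letter, the bound leaves no value strictly
-- between the two for the 2.
bound⇒avoids : (π : Permutation′ (suc n)) (ρ : Permutation′ n) → Tail π ρ → Avoids31-2 ρ →
               FirstBound (toℕ (π ⟨$⟩ʳ 0F)) ρ → Avoids31-2 π
bound⇒avoids π ρ tail avoids bound (suc i , suc j , suc k , j≡ , s<s j<k , πj<πk , πk<πi) =
  avoids (i , j , k , ℕ.suc-injective j≡ , j<k , tail-cancel π ρ tail πj<πk , tail-cancel π ρ tail πk<πi)
bound⇒avoids {zero} π ρ tail avoids bound (zero , suc () , _)
bound⇒avoids {suc n} π ρ tail avoids bound (zero , suc zero , k , j≡ , j<k , π1<πk , πk<c) =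
  ℕ.<-irrefl refl (begin-strict
    toℕ (π ⟨$⟩ʳ 0F)                             ≤⟨ bound ⟩
    suc (toℕ (ρ ⟨$⟩ʳ 0F))                       ≤⟨ s≤s (≤-punchIn (π ⟨$⟩ʳ 0F) (ρ ⟨$⟩ʳ 0F)) ⟩
    suc (toℕ (punchIn (π ⟨$⟩ʳ 0F) (ρ ⟨$⟩ʳ 0F))) ≡⟨ cong (suc ∘ toℕ) (tail 0F) ⟨
    suc (toℕ (π ⟨$⟩ʳ 1F))                       ≤⟨ π1<πk ⟩
    toℕ (π ⟨$⟩ʳ k)                              <⟨ πk<c ⟩
    toℕ (π ⟨$⟩ʳ 0F)                             ∎)
  where open ℕ.≤-Reasoning

tail-remove : (π : Permutation′ (suc n)) → Tail π (remove 0F π)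
tail-remove π = punchIn-permute π 0F

tail-insert : (c : Fin (suc n)) (ρ : Permutation′ n) → Tail (insert 0F c ρ) ρ
tail-insert c ρ = insert-punchIn 0F c ρ

tail-unique : (π π′ : Permutation′ (suc n)) (ρ ρ′ : Permutation′ n) → Tail π ρ → Tail π′ ρ′ → π ≈ π′ → ρ ≈ ρ′
tail-unique π π′ ρ ρ′ tail tail′ π≈π′ i = punchIn-injective (π ⟨$⟩ʳ 0F) _ _
  (trans (sym (tail i)) (trans (π≈π′ (suc i)) (trans (tail′ i) (cong (λ c → punchIn c _) (sym (π≈π′ 0F))))))

-- Counting the avoiders

Avoiders : ℕ → ℕ → Setoid 0ℓ 0ℓ
Avoiders n h = On.setoid {B = Σ (Permutation′ n) λ π → Avoids31-2 π × FirstBound h π}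
                 (Fin n →-setoid Fin n) (λ (π , _) → π ⟨$⟩ʳ_)

_↔ₛ_ : Setoid 0ℓ 0ℓ → Setoid 0ℓ 0ℓ → Set
_↔ₛ_ = Inverse

avoiders-zero : Avoiders 0 0 ↔ₛ setoid (Fin 1)
avoiders-zero = record
  { to = λ _ → 0F
  ; from = λ _ → Permutation.id , (λ ()) , refl
  ; to-cong = λ _ → refl
  ; from-cong = λ _ ()
  ; inverse = (λ { {0F} _ → refl }) , λ _ ()
  }

-- For a nonempty word the bounds 0 and 1 are both vacuous. This matches the rule for `ballot` at
-- height 0.
avoiders-suc-0 : Avoiders (suc n) 0 ↔ₛ Avoiders (suc n) 1
avoiders-suc-0 = record
  { to = λ (π , avoids , _) → π , avoids , s≤s z≤n
  ; from = λ (π , avoids , _) → π , avoids , z≤n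
  ; to-cong = λ eq → eq
  ; from-cong = λ eq → eq
  ; inverse = (λ eq → eq) , λ eq → eq
  }

avoiders-empty : n < h → Avoiders n h ↔ₛ setoid (Fin 0)
avoiders-empty n<h = record
  { to = λ (π , _ , bound) → contradiction (bound≤n π bound) (ℕ.<⇒≱ n<h)
  ; from = λ ()
  ; to-cong = λ { {π , _ , bound} → contradiction (bound≤n π bound) (ℕ.<⇒≱ n<h) }
  ; from-cong = λ { {()} }
  ; inverse = (λ { {()} }) , λ { {π , _ , bound} → contradiction (bound≤n π bound) (ℕ.<⇒≱ n<h) }
  }

-- Either the first letter exceeds h, or it equals h and is deleted.
avoiders-split : ∀ n h → (Avoiders (suc n) (2 + h) ⊎ₛ Avoiders n h) ↔ₛ Avoiders (suc n) (suc h)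
avoiders-split n h = Bijection⇒Inverse record
  { to = to
  ; cong = to-cong
  ; bijective = injective , surjective
  }
  where
  open Setoid (Avoiders (suc n) (2 + h) ⊎ₛ Avoiders n h) using () renaming (Carrier to Source; _≈_ to _≈ₛ_)
  open Setoid (Avoiders (suc n) (suc h)) using () renaming (Carrier to Target; _≈_ to _≈ₜ_)

  -- The value `h` is a legal first letter because a bound `h` on `ρ` forces `h ≤ n`.
  first : (ρ : Permutation′ n) → FirstBound h ρ → Fin (suc n)
  first ρ bound = fromℕ< (s≤s (bound≤n ρ bound))

  toℕ-first : ∀ ρ bound → toℕ (first ρ bound) ≡ h
  toℕ-first ρ bound = toℕ-fromℕ< (s≤s (bound≤n ρ bound))

  to : Source → Target
  to (inj₁ (π , avoids , bound)) = π , avoids , ℕ.<⇒≤ bound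
  to (inj₂ (ρ , avoids , bound)) =
    insert 0F c ρ ,
    -- The bound on `ρ` is exactly the condition for prefixing the letter `h` to preserve avoidance,
    -- so the recurrence closes on one family.
    bound⇒avoids (insert 0F c ρ) ρ (tail-insert c ρ) avoids (subst (λ l → FirstBound l ρ) (sym (toℕ-first ρ bound)) bound) ,
    s≤s (ℕ.≤-reflexive (sym (toℕ-first ρ bound)))
    where c = first ρ bound

  to-cong : ∀ {x y} → x ≈ₛ y → to x ≈ₜ to y
  to-cong (inj₁ π≈π′) = π≈π′
  to-cong {inj₂ (ρ , _ , bound)} {inj₂ (ρ′ , _ , bound′)} (inj₂ ρ≈ρ′) zero =
    toℕ-injective (trans (toℕ-first ρ bound) (sym (toℕ-first ρ′ bound′)))
  to-cong {inj₂ (ρ , _ , bound)} {inj₂ (ρ′ , _ , bound′)} (inj₂ ρ≈ρ′) (suc i) =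
    trans (tail-insert c ρ i) (trans (cong₂ punchIn c≡c′ (ρ≈ρ′ i)) (sym (tail-insert c′ ρ′ i)))
    where
    c = first ρ bound
    c′ = first ρ′ bound′
    c≡c′ : c ≡ c′
    c≡c′ = toℕ-injective (trans (toℕ-first ρ bound) (sym (toℕ-first ρ′ bound′)))

  injective : ∀ {x y} → to x ≈ₜ to y → x ≈ₛ y
  injective {inj₁ _} {inj₁ _} eq = inj₁ eq
  injective {inj₁ (_ , _ , bound)} {inj₂ (ρ , _ , bound′)} eq =
    contradiction (trans (cong toℕ (eq 0F)) (toℕ-first ρ bound′)) (ℕ.>⇒≢ (ℕ.s≤s⁻¹ bound))
  injective {inj₂ (ρ , _ , bound)} {inj₁ (_ , _ , bound′)} eq =
    contradiction (trans (cong toℕ (sym (eq 0F))) (toℕ-first ρ bound)) (ℕ.>⇒≢ (ℕ.s≤s⁻¹ bound′))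
  injective {inj₂ (ρ , _ , bound)} {inj₂ (ρ′ , _ , bound′)} eq =
    inj₂ (tail-unique (insert 0F (first ρ bound) ρ) (insert 0F (first ρ′ bound′) ρ′) ρ ρ′
            (tail-insert (first ρ bound) ρ) (tail-insert (first ρ′ bound′) ρ′) eq)

  preimage : ∀ y → ∃ λ x → to x ≈ₜ y
  preimage (π , avoids , bound) with ℕ.m≤n⇒m<n∨m≡n bound
  ... | inj₁ h< = inj₁ (π , avoids , h<) , λ _ → refl
  ... | inj₂ h≡ = inj₂ (ρ , avoids-tail π ρ (tail-remove π) avoids , bound′) , λ i →
      trans (cong (λ c → insert 0F c ρ ⟨$⟩ʳ i) (toℕ-injective (trans (toℕ-first ρ bound′) (ℕ.suc-injective h≡))))
            (insert-remove 0F π i)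
    where
    ρ = remove 0F π
    -- Here the first letter of `π` is `h`, so avoidance returns the bound needed on the tail.
    bound′ : FirstBound h ρ
    bound′ = subst (λ l → FirstBound l ρ) (sym (ℕ.suc-injective h≡)) (avoids⇒bound π ρ (tail-remove π) avoids)

  surjective : ∀ y → ∃ λ x → ∀ {z} → z ≈ₛ x → to z ≈ₜ y
  surjective y with preimage y
  ... | x , tox≈y = x , λ {z} z≈x → Setoid.trans (Avoiders (suc n) (suc h)) {to z} {to x} {y} (to-cong z≈x) tox≈y

_⊕_ : ∀ {S T p q} → S ↔ₛ setoid (Fin p) → T ↔ₛ setoid (Fin q) → (S ⊎ₛ T) ↔ₛ setoid (Fin (p + q))
f ⊕ g = Composition.inverse (f ⊎-inverse g) (Composition.inverse (Pointwise-≡↔≡ _ _) (Symmetry.inverse +↔⊎))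

-- The slack `r` is length minus bound. Raising the bound lowers `r` and is an up step of the path;
-- deleting the first letter keeps `r`, lowers `h` and is a down step.
avoiders-card : ∀ r h {n} → n ≡ h + r → Avoiders n h ↔ₛ setoid (Fin (ballot r h))
avoiders-card zero zero refl = avoiders-zero
-- With no slack the bound cannot be raised: the first letter is the greatest one, and by recursion
-- only the decreasing permutation remains.
avoiders-card zero (suc h) refl = Composition.inverse (Symmetry.inverse (avoiders-split (h + 0) h))
  (avoiders-empty (s≤s (s≤s (ℕ.≤-reflexive (ℕ.+-identityʳ h)))) ⊕ avoiders-card zero h refl)
avoiders-card (suc r) zero refl = Composition.inverse avoiders-suc-0 (avoiders-card r 1 refl)
avoiders-card (suc r) (suc h) refl = Composition.inverse (Symmetry.inverse (avoiders-split (h + suc r) h))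
  (avoiders-card r (2 + h) (cong suc (ℕ.+-suc h r)) ⊕ avoiders-card (suc r) h refl)

𝒮↔avoiders : ∀ n → 𝒮 n pattern32-3→1 ↔ₛ Avoiders n 0
𝒮↔avoiders n = record
  { to = λ (π , avoids) → π , avoids ∘ 31-2⇒arrow π , bound π
  ; from = λ (π , avoids , _) → π , avoids ∘ arrow⇒31-2 π
  ; to-cong = λ eq → eq
  ; from-cong = λ eq → eq
  ; inverse = (λ eq → eq) , λ eq → eq
  }
  where
  bound : ∀ {n} (π : Permutation′ n) → FirstBound 0 π
  bound {zero} π = refl
  bound {suc n} π = z≤n

theorem6p3 : (n : ℕ) → 1 ≤ n → HasCardinality (𝒮 n pattern32-3→1) (catalan n)
theorem6p3 n _ = subst (HasCardinality (𝒮 n pattern32-3→1)) (ballot-catalan n)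
  (Composition.inverse (𝒮↔avoiders n) (avoiders-card n 0 refl))
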